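{- For every ordinal $\alpha$: $\alpha$ is the ordinal height of some automatic well-founded partial order if and only if $\alpha<\omega^\omega$.
   Context: Automatic structures: for a finite alphabet $\Sigma$ and a padding symbol $\diamond\notin\Sigma$, the convolution of a tuple $(w_1,\dots,w_n)$ of words over $\Sigma$ is the word of length $\max_i|w_i|$ over the alphabet $(\Sigma\cup\{\diamond\})^n$ whose $k$-th letter is $(\sigma_1,\dots,\sigma_n)$, where $\sigma_i$ is the $k$-th letter of $w_i$ if $k\le |w_i|$ and $\diamond$ otherwise. An $n$-ary relation on $\Sigma^\star$ is regular if the set of convolutions of its tuples is accepted by a finite automaton. A structure $(A;R_1,\dots,R_m)$ with finitely many relations is automatic over $\Sigma$ if $A\subseteq\Sigma^\star$ is a regular language and each $R_i$ is a regular relation; a structure is called automatic if it is isomorphic to such a structure. Ordinal height: for a well-founded binary relation $R$ on $A$ (no infinite sequence $x_1,x_2,\dots$ with $(x_{i+1},x_i)\in R$ for all $i$), define $r_{\mathcal A}(x)=0$ for $R$-minimal $x$ and $r_{\mathcal A}(z)=\sup\{r_{\mathcal A}(y)+1:(y,z)\in R\}$ otherwise; the ordinal height of $(A;R)$ is $r(\mathcal A)=\sup\{r_{\mathcal A}(x):x\in A\}$. For a partial order $\le$, the relevant relation is the strict order $<$. -}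

module Defs where

open import Data.Nat using (ℕ; zero; suc)
open import Data.Fin using (Fin)
open import Data.Bool using (Bool; true)
open import Data.List using (List; []; _∷_; foldl)
open import Data.Maybe using (Maybe; just; nothing)
open import Data.Product using (Σ; ∃; _×_; _,_; proj₁)
open import Data.Sum using (_⊎_; inj₁; inj₂)
open import Data.Empty using (⊥; ⊥-elim)
open import Data.Unit using (⊤)
open import Relation.Nullary using (¬_)
open import Relation.Binary.PropositionalEquality using (_≡_)
open import Induction.WellFounded using (Acc; acc; WellFounded)

record DFA (A : Set) : Set where
  field
    nStates : ℕ
    start   : Fin nStates
    δ       : Fin nStates → A → Fin nStates
    final   : Fin nStates → Bool

Accepts : {A : Set} → DFA A → List A → Set
Accepts D w = DFA.final D (foldl (DFA.δ D) (DFA.start D) w) ≡ true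

-- Padded alphabet: nothing plays the role of the padding symbol ◇.
Padded : ℕ → Set
Padded k = Maybe (Fin k)

conv : {k : ℕ} → List (Fin k) → List (Fin k) → List (Padded k × Padded k)
conv []      []      = []
conv (a ∷ u) []      = (just a , nothing) ∷ conv u []
conv []      (b ∷ v) = (nothing , just b) ∷ conv [] v
conv (a ∷ u) (b ∷ v) = (just a , just b) ∷ conv u v

-- sup I f denotes the least ordinal strictly above every f i.
data Ord : Set₁ where
  sup : (I : Set) → (I → Ord) → Ord

mutual
  _≤ₒ_ : Ord → Ord → Set
  sup I f ≤ₒ β = (i : I) → f i <ₒ β

  _<ₒ_ : Ord → Ord → Set
  α <ₒ sup J g = Σ J (λ j → α ≤ₒ g j)

_≈ₒ_ : Ord → Ord → Set
α ≈ₒ β = (α ≤ₒ β) × (β ≤ₒ α)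

infix 4 _≤ₒ_ _<ₒ_ _≈ₒ_

zeroₒ : Ord
zeroₒ = sup ⊥ ⊥-elim

_+ₒ_ : Ord → Ord → Ord
sup J g +ₒ sup I f = sup (J ⊎ I) h
  where
    h : J ⊎ I → Ord
    h (inj₁ j) = g j
    h (inj₂ i) = sup J g +ₒ f i

_·ℕ_ : Ord → ℕ → Ord
α ·ℕ zero  = zeroₒ
α ·ℕ suc k = (α ·ℕ k) +ₒ α

ω^ : ℕ → Ord
ω^ zero    = sup ⊤ (λ _ → zeroₒ)
ω^ (suc n) = sup ℕ (λ k → ω^ n ·ℕ k)

ω^ω : Ord
ω^ω = sup ℕ ω^

module Height {D : Set} (_<_ : D → D → Set) (wf : WellFounded _<_) where

  rankAcc : (x : D) → Acc _<_ x → Ord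
  rankAcc x (acc rs) = sup (Σ D (λ y → y < x)) (λ p → rankAcc (proj₁ p) (rs (Data.Product.proj₂ p)))

  rank : D → Ord
  rank x = rankAcc x (wf x)

  -- r(A) = sup { r(x) : x ∈ A } = sup { r(y) + 1 : y < x, x ∈ A }
  height : Ord
  height = sup (Σ D (λ x → Σ D (λ y → y < x))) (λ p → rank (proj₁ (Data.Product.proj₂ p)))

record AutomaticWFPO : Set where
  field
    k    : ℕ
    Dom  : DFA (Fin k)
    Ord≤ : DFA (Padded k × Padded k)

  Carrier : Set
  Carrier = Σ (List (Fin k)) (Accepts Dom)

  _≤_ : Carrier → Carrier → Set
  x ≤ y = Accepts Ord≤ (conv (proj₁ x) (proj₁ y))

  _<_ : Carrier → Carrier → Set
  x < y = (x ≤ y) × ¬ (proj₁ x ≡ proj₁ y)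

  field
    refl≤    : ∀ x → x ≤ x
    antisym≤ : ∀ x y → x ≤ y → y ≤ x → proj₁ x ≡ proj₁ y
    trans≤   : ∀ x y z → x ≤ y → y ≤ z → x ≤ z
    wf<      : WellFounded _<_

  height : Ord
  height = Height.height _<_ wf<

{-# OPTIONS --safe #-}
module Submission where

-- Write ⟦ v ⟧ for the ordinal below ωⁿ whose Cantor normal form has coefficients v ∈ ℕⁿ, so that
-- the lexicographic order on ℕⁿ is the order of these ordinals.
--
-- Every α < ω^ω is some ⟦ d ⟧. With coefficients in unary, ℕⁿ becomes a regular language on which
-- the order is regular, so {v : v ≼ d} is an automatic linear order, and its height is ⟦ d ⟧.
--
-- Conversely, for u in an automatic well-founded partial order, {x : x < u} is the union of
-- finitely many singletons and of the pieces {v w : v w < u} for |v| = |u| + 1. The isomorphism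
-- type of a piece is determined by the states reached by the automata after reading v, (v , u) and
-- (v , v). There are finitely many such triples, so there is an M such that every piece of height
-- at most some ωᵐ, that is, with a strictly monotone map to some ℕᵐ, has height at most ωᴹ. By
-- well-founded induction all ranks are below ω^(M+1): if this holds below u, then all pieces have
-- height at most ω^(M+1), hence at most ωᴹ, and the rank of u is at most the natural sum (pointwise
-- addition of coefficient vectors) of the finitely many heights of singletons and pieces.

open import Defs
open import Axiom.ExcludedMiddle using (ExcludedMiddle)
open import Data.Bool as Bool using (true)
open import Data.Empty using (⊥; ⊥-elim)
open import Data.Fin as Fin using (Fin; zero; suc)
open import Data.Fin.Patterns using (0F; 1F)
import Data.Fin.Properties as Fin
open import Data.List as List
  using (List; []; _∷_; _++_; _∷ʳ_; allFin; cartesianProduct; drop; foldl; head; length; tails;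
         upTo)
open import Data.List.Membership.Propositional using (_∈_)
open import Data.List.Membership.Propositional.Properties
  using (∈-allFin; ∈-cartesianProduct⁺; ∈-cartesianProduct⁻; ∈-lookup; ∈-upTo⁺; ∈-upTo⁻)
open import Data.List.Properties using (++-cancelˡ; ++-identityʳ; foldl-++; length-++; ∷ʳ-++)
open import Data.List.Relation.Binary.Lex.Strict as ListLex using (base; halt; this; next)
import Data.List.Relation.Binary.Pointwise as ListPointwise
import Data.List.Relation.Unary.All as All
import Data.List.Relation.Unary.All.Properties as All using (map⁻)
open import Data.List.Relation.Unary.Any as Any using (here; there)
import Data.List.Relation.Unary.Any.Properties as Any using (lookup-index)
open import Data.Maybe using (just; nothing)
open import Data.Nat as ℕ using (ℕ; zero; suc; pred; _+_; _≤_; _<_; z≤n; s≤s; z<s; s<s)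
open import Data.Nat.Induction using (<-wellFounded)
import Data.Nat.Properties as ℕ
open import Data.List.Extrema ℕ.≤-totalOrder using (max; xs≤max)
open import Data.Product using (Σ; ∃; _×_; _,_; proj₁; proj₂; swap)
open import Data.Product.Function.NonDependent.Propositional using (_×-⇔_)
open import Data.Sum as Sum using (_⊎_; inj₁; inj₂)
open import Data.Unit using (⊤; tt)
open import Data.Vec using (Vec; []; _∷_; replicate; zipWith)
open import Data.Vec.Relation.Binary.Lex.Strict as VecLex using (Lex-<; this; next)
open import Data.Vec.Relation.Binary.Pointwise.Inductive
  using (Pointwise; Pointwise-≡⇒≡; ≡⇒Pointwise-≡)
open import Function using (_∘_; _on_; id)
open import Function.Bundles using (_⇔_; mk⇔; module Equivalence)
open import Function.Construct.Composition using (_⇔-∘_)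
open import Function.Construct.Identity using (⇔-id)
open import Induction.WellFounded using (Acc; acc; WellFounded; module Subrelation)
open import Level using (0ℓ; Lift; lift; lower)
open import Relation.Binary
  using (Rel; _Preserves_⟶_; _Respects_; Transitive; Trans; Tri; tri<; tri≈; tri>;
         IsPartialOrder; IsStrictTotalOrder)
import Relation.Binary.Construct.On as On
import Relation.Binary.Construct.StrictToNonStrict as StrictToNonStrict
open import Relation.Binary.PropositionalEquality
  using (_≡_; _≢_; refl; sym; trans; cong; subst; subst₂; respˡ; respʳ; module ≡-Reasoning)
open import Relation.Binary.PropositionalEquality.Properties using (isEquivalence)
open import Relation.Binary.Structures.Biased using (isStrictTotalOrderᶜ)
open import Relation.Nullary using (¬_; Dec; does; yes; no; contradiction)
open import Relation.Nullary.Decidable using (_×-dec_; decidable-stable; map′)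
open import Relation.Unary using (Pred; Decidable; _∩_; _∪_; _⊆_; ⋃; ∅; U)

open Equivalence using (to; from)
open ≡-Reasoning

private variable
  A B Q     : Set
  a b k m n : ℕ
  α β γ     : Ord

≤ₒ-refl : ∀ α → α ≤ₒ α
≤ₒ-refl (sup I f) i = i , ≤ₒ-refl (f i)

mutual
  ≤ₒ-trans : α ≤ₒ β → β ≤ₒ γ → α ≤ₒ γ
  ≤ₒ-trans {sup I f} p q i = <ₒ-≤ₒ-trans (p i) q

  <ₒ-≤ₒ-trans : α <ₒ β → β ≤ₒ γ → α <ₒ γ
  <ₒ-≤ₒ-trans {β = sup J g} (j , p) q = ≤ₒ-<ₒ-trans p (q j)

  ≤ₒ-<ₒ-trans : α ≤ₒ β → β <ₒ γ → α <ₒ γ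
  ≤ₒ-<ₒ-trans {γ = sup K h} p (k , q) = k , ≤ₒ-trans p q

<ₒ⇒≤ₒ : α <ₒ β → α ≤ₒ β
<ₒ⇒≤ₒ {sup I f} {sup J g} (j , p) i = j , <ₒ⇒≤ₒ (p i)

<ₒ-irrefl : ¬ α <ₒ α
<ₒ-irrefl {sup I f} (i , α≤fi) = <ₒ-irrefl (α≤fi i)

≈ₒ-trans : α ≈ₒ β → β ≈ₒ γ → α ≈ₒ γ
≈ₒ-trans (α≤β , β≤α) (β≤γ , γ≤β) = ≤ₒ-trans α≤β β≤γ , ≤ₒ-trans γ≤β β≤α

below⇒≤ₒ : (∀ {γ} → γ <ₒ α → γ <ₒ β) → α ≤ₒ β
below⇒≤ₒ {sup I f} below i = below (i , ≤ₒ-refl (f i))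

+ₒ-upperˡ : ∀ α β → α ≤ₒ α +ₒ β
+ₒ-upperˡ (sup J g) (sup I f) j = inj₁ j , ≤ₒ-refl (g j)

+ₒ-upperʳ : ∀ α β → β ≤ₒ α +ₒ β
+ₒ-upperʳ α@(sup J g) (sup I f) i = inj₂ i , +ₒ-upperʳ α (f i)

mutual
  +ₒ-monoʳ-≤ : ∀ α → β ≤ₒ γ → α +ₒ β ≤ₒ α +ₒ γ
  +ₒ-monoʳ-≤ {sup I f} {sup K h} (sup J g) p (inj₁ j) = inj₁ j , ≤ₒ-refl (g j)
  +ₒ-monoʳ-≤ {sup I f} {sup K h} α@(sup J g) p (inj₂ i) = +ₒ-monoʳ-< α (p i)

  +ₒ-monoʳ-< : ∀ α → β <ₒ γ → α +ₒ β <ₒ α +ₒ γ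
  +ₒ-monoʳ-< {γ = sup K h} α@(sup J g) (k , p) = inj₂ k , +ₒ-monoʳ-≤ α p

<ₒ-+ₒ-split : ∀ α β → γ <ₒ α +ₒ β → γ <ₒ α ⊎ ∃ λ δ → δ <ₒ β × γ ≤ₒ α +ₒ δ
<ₒ-+ₒ-split (sup J g) (sup I f) (inj₁ j , γ≤) = inj₁ (j , γ≤)
<ₒ-+ₒ-split (sup J g) (sup I f) (inj₂ i , γ≤) = inj₂ (f i , (i , ≤ₒ-refl (f i)) , γ≤)

suc-closed⇒respects-≤ : {P : Pred ℕ 0ℓ} → (∀ {m} → P m → P (suc m)) → P Respects _≤_
suc-closed⇒respects-≤ {P} step m≤n = go (ℕ.≤⇒≤′ m≤n)
  where
  go : m ℕ.≤′ n → P m → P n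
  go (ℕ.≤′-reflexive refl) p = p
  go (ℕ.≤′-step m≤′n)      p = step (go m≤′n p)

·ℕ-monoʳ-≤ : ∀ α → a ≤ b → α ·ℕ a ≤ₒ α ·ℕ b
·ℕ-monoʳ-≤ {a} α a≤b =
  suc-closed⇒respects-≤ (λ p → ≤ₒ-trans p (+ₒ-upperˡ _ α)) a≤b (≤ₒ-refl (α ·ℕ a))

≤ω^⇒<ω^suc : ∀ n → α ≤ₒ ω^ n → α <ₒ ω^ (suc n)
≤ω^⇒<ω^suc n α≤ω^n = 1 , ≤ₒ-trans α≤ω^n (+ₒ-upperʳ zeroₒ (ω^ n))

infix 4 _≺_ _≼_

_≺_ : Rel (Vec ℕ n) 0ℓ
_≺_ = Lex-< _≡_ _<_

≺-wellFounded : WellFounded (_≺_ {n})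
≺-wellFounded = VecLex.<-wellFounded trans (proj₁ ℕ.<-resp₂-≡) <-wellFounded

≺-isStrictTotalOrder : IsStrictTotalOrder _≡_ (_≺_ {n})
≺-isStrictTotalOrder = isStrictTotalOrderᶜ record
  { isEquivalence = isEquivalence
  ; trans         = Lex.trans
  ; compare       = λ u v → compare≡ (Lex.compare u v)
  }
  where
  module Lex {n} = IsStrictTotalOrder (VecLex.<-isStrictTotalOrder ℕ.<-isStrictTotalOrder {n})

  compare≡ : {u v : Vec ℕ n} →
    Tri (u ≺ v) (Pointwise _≡_ u v) (v ≺ u) → Tri (u ≺ v) (u ≡ v) (v ≺ u)
  compare≡ (tri< u≺v u≋̸v v⊀u) = tri< u≺v (u≋̸v ∘ ≡⇒Pointwise-≡) v⊀u
  compare≡ (tri≈ u⊀v u≋v v⊀u)  = tri≈ u⊀v (Pointwise-≡⇒≡ u≋v) v⊀u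
  compare≡ (tri> u⊀v u≋̸v v≺u) = tri> u⊀v (u≋̸v ∘ ≡⇒Pointwise-≡) v≺u

module ≺ {n} = IsStrictTotalOrder (≺-isStrictTotalOrder {n})

_≼_ : Rel (Vec ℕ n) 0ℓ
_≼_ = StrictToNonStrict._≤_ _≡_ _≺_

module ≼ {n} = IsPartialOrder
  (StrictToNonStrict.isPartialOrder _≡_ _≺_ (≺.isStrictPartialOrder {n}))

≼-≺-trans : Trans (_≼_ {n}) _≺_ _≺_
≼-≺-trans = StrictToNonStrict.≤-<-trans _≡_ _≺_ sym ≺.trans (respˡ _≺_)

≺-≼-trans : Trans (_≺_ {n}) _≼_ _≺_
≺-≼-trans = StrictToNonStrict.<-≤-trans _≡_ _≺_ ≺.trans (respʳ _≺_)

𝟎 : Vec ℕ n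
𝟎 = replicate _ 0

infixl 6 _⊞_

_⊞_ : Vec ℕ n → Vec ℕ n → Vec ℕ n
_⊞_ = zipWith _+_

⊞-monoˡ-≺ : (w : Vec ℕ n) → (_⊞ w) Preserves _≺_ ⟶ _≺_
⊞-monoˡ-≺ (c ∷ w) (this a<b eq)   = this (ℕ.+-monoˡ-< c a<b) eq
⊞-monoˡ-≺ (c ∷ w) (next refl u≺v) = next refl (⊞-monoˡ-≺ w u≺v)

⊞-monoʳ-≺ : (w : Vec ℕ n) → (w ⊞_) Preserves _≺_ ⟶ _≺_
⊞-monoʳ-≺ (c ∷ w) (this a<b eq)   = this (ℕ.+-monoʳ-< c a<b) eq
⊞-monoʳ-≺ (c ∷ w) (next refl u≺v) = next refl (⊞-monoʳ-≺ w u≺v)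

⊞-monoˡ-≼ : (w : Vec ℕ n) → (_⊞ w) Preserves _≼_ ⟶ _≼_
⊞-monoˡ-≼ w = Sum.map (⊞-monoˡ-≺ w) (cong (_⊞ w))

⊞-monoʳ-≼ : (w : Vec ℕ n) → (w ⊞_) Preserves _≼_ ⟶ _≼_
⊞-monoʳ-≼ w = Sum.map (⊞-monoʳ-≺ w) (cong (w ⊞_))

⟦_⟧ : Vec ℕ n → Ord
⟦ [] ⟧              = zeroₒ
⟦_⟧ {suc n} (a ∷ v) = (ω^ n ·ℕ a) +ₒ ⟦ v ⟧

⟦⟧<ω^ : (v : Vec ℕ n) → ⟦ v ⟧ <ₒ ω^ n
⟦⟧<ω^ []              = tt , ≤ₒ-refl zeroₒ
⟦⟧<ω^ {suc n} (a ∷ v) = suc a , +ₒ-monoʳ-≤ (ω^ n ·ℕ a) (<ₒ⇒≤ₒ (⟦⟧<ω^ v))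

⟦⟧-mono-≺ : {u v : Vec ℕ n} → u ≺ v → ⟦ u ⟧ <ₒ ⟦ v ⟧
⟦⟧-mono-≺ {suc n} {a ∷ u} {b ∷ v} (this a<b _) =
  <ₒ-≤ₒ-trans (+ₒ-monoʳ-< (ω^ n ·ℕ a) (⟦⟧<ω^ u))
    (≤ₒ-trans (·ℕ-monoʳ-≤ (ω^ n) a<b) (+ₒ-upperˡ (ω^ n ·ℕ b) ⟦ v ⟧))
⟦⟧-mono-≺ {suc n} {a ∷ u} (next refl u≺v) = +ₒ-monoʳ-< (ω^ n ·ℕ a) (⟦⟧-mono-≺ u≺v)

⟦⟧-mono-≼ : {u v : Vec ℕ n} → u ≼ v → ⟦ u ⟧ ≤ₒ ⟦ v ⟧
⟦⟧-mono-≼ (inj₁ u≺v)          = <ₒ⇒≤ₒ (⟦⟧-mono-≺ u≺v)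
⟦⟧-mono-≼ {u = u} (inj₂ refl) = ≤ₒ-refl ⟦ u ⟧

⟦⟧-cancel-≺ : {u v : Vec ℕ n} → ⟦ u ⟧ <ₒ ⟦ v ⟧ → u ≺ v
⟦⟧-cancel-≺ {u = u} {v} u<v with ≺.compare u v
... | tri< u≺v _ _  = u≺v
... | tri≈ _ refl _ = contradiction u<v <ₒ-irrefl
... | tri> _ _ v≺u  = contradiction (<ₒ-≤ₒ-trans u<v (⟦⟧-mono-≼ (inj₁ v≺u))) <ₒ-irrefl

⟦⟧-cancel-≼ : {u v : Vec ℕ n} → ⟦ u ⟧ ≤ₒ ⟦ v ⟧ → u ≼ v
⟦⟧-cancel-≼ {u = u} {v} u≤v with ≺.compare u v
... | tri< u≺v _ _ = inj₁ u≺v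
... | tri≈ _ u≡v _ = inj₂ u≡v
... | tri> _ _ v≺u = contradiction (≤ₒ-<ₒ-trans u≤v (⟦⟧-mono-≺ v≺u)) <ₒ-irrefl

ω^-cofinal : β <ₒ ω^ n → ∃ λ (v : Vec ℕ n) → β ≤ₒ ⟦ v ⟧
ω^-cofinal {n = zero}  (tt , β≤0) = [] , β≤0
ω^-cofinal {n = suc n} (a , β≤)   = a ∷ 𝟎 , ≤ₒ-trans β≤ (+ₒ-upperˡ (ω^ n ·ℕ a) ⟦ 𝟎 {n} ⟧)

ω^·ℕ-cofinal : ∀ a → β <ₒ ω^ n ·ℕ a → ∃ λ b → ∃ λ (v : Vec ℕ n) → b < a × β ≤ₒ ⟦ b ∷ v ⟧
ω^·ℕ-cofinal {n = n} (suc a) β< with <ₒ-+ₒ-split (ω^ n ·ℕ a) (ω^ n) β<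
... | inj₁ β<′ =
        let b , v , b<a , β≤ = ω^·ℕ-cofinal a β<′
        in  b , v , ℕ.m<n⇒m<1+n b<a , β≤
... | inj₂ (δ , δ<ω^n , β≤) =
        let v , δ≤ = ω^-cofinal δ<ω^n
        in  a , v , ℕ.n<1+n a , ≤ₒ-trans β≤ (+ₒ-monoʳ-≤ (ω^ n ·ℕ a) δ≤)

⟦⟧-cofinal : (v : Vec ℕ n) → β <ₒ ⟦ v ⟧ → ∃ λ u → u ≺ v × β ≤ₒ ⟦ u ⟧
⟦⟧-cofinal {suc n} (a ∷ v) β< with <ₒ-+ₒ-split (ω^ n ·ℕ a) ⟦ v ⟧ β<
... | inj₁ β<′ =
        let b , u , b<a , β≤ = ω^·ℕ-cofinal a β<′
        in  b ∷ u , this b<a refl , β≤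
... | inj₂ (δ , δ<v , β≤) =
        let u , u≺v , δ≤ = ⟦⟧-cofinal v δ<v
        in  a ∷ u , next refl u≺v , ≤ₒ-trans β≤ (+ₒ-monoʳ-≤ (ω^ n ·ℕ a) δ≤)

module RankProperties {_<_ : Rel A 0ℓ} (wf : WellFounded _<_) where

  open Height _<_ wf

  private
    rankAcc-irrelevant : ∀ {x} (p q : Acc _<_ x) → rankAcc x p ≤ₒ rankAcc x q
    rankAcc-irrelevant (acc rs) (acc ss) (y , y<x) =
      (y , y<x) , rankAcc-irrelevant (rs y<x) (ss y<x)

  rank-mono-< : ∀ {y x} → y < x → rank y <ₒ rank x
  rank-mono-< {y} {x} y<x with wf x
  ... | acc rs = (y , y<x) , rankAcc-irrelevant (wf y) (rs y<x)

  rank-least : ∀ {x} → (∀ {y} → y < x → rank y <ₒ β) → rank x ≤ₒ β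
  rank-least {x = x} bound with wf x
  ... | acc rs = λ (y , y<x) → ≤ₒ-<ₒ-trans (rankAcc-irrelevant (rs y<x) (wf y)) (bound y<x)

  rank≤labelling : {φ : A → Ord} {X : Pred A 0ℓ} →
    (∀ {x y} → X x → y < x → X y) → (∀ {x y} → X x → y < x → φ y <ₒ φ x) →
    ∀ {x} → X x → rank x ≤ₒ φ x
  rank≤labelling {φ} {X} closed strict {x} = go (wf x)
    where
    go : ∀ {x} → Acc _<_ x → X x → rank x ≤ₒ φ x
    go (acc rs) x∈X = rank-least λ y<x →
      ≤ₒ-<ₒ-trans (go (rs y<x) (closed x∈X y<x)) (strict x∈X y<x)

  labelling≤rank : {φ : A → Ord} →
    (∀ x {β} → β <ₒ φ x → ∃ λ y → y < x × β ≤ₒ φ y) → ∀ x → φ x ≤ₒ rank x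
  labelling≤rank {φ} cofinal x = go (wf x)
    where
    go : ∀ {x} → Acc _<_ x → φ x ≤ₒ rank x
    go {x} (acc rs) = below⇒≤ₒ λ β<φx →
      let y , y<x , β≤φy = cofinal x β<φx
      in  ≤ₒ-<ₒ-trans (≤ₒ-trans β≤φy (go (rs y<x))) (rank-mono-< y<x)

  height≈rank : ∀ {t} → (∀ {x y} → y < x → y < t) → height ≈ₒ rank t
  height≈rank {t} below-t =
    (λ (_ , y , y<x) → rank-mono-< (below-t y<x)) ,
    rank-least λ {y} y<t → (t , y , y<t) , ≤ₒ-refl (rank y)

Ranking : Rel A 0ℓ → ℕ → Set
Ranking {A} _<_ n = Σ (A → Vec ℕ n) λ f → f Preserves _<_ ⟶ _≺_

ranking-suc : {_<_ : Rel A 0ℓ} → Ranking _<_ n → Ranking _<_ (suc n)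
ranking-suc (f , f-mono) = (0 ∷_) ∘ f , next refl ∘ f-mono

ranking-∘ : {_<₁_ : Rel A 0ℓ} {_<₂_ : Rel B 0ℓ} (h : A → B) → h Preserves _<₁_ ⟶ _<₂_ →
  Ranking _<₂_ n → Ranking _<₁_ n
ranking-∘ h h-mono (f , f-mono) = f ∘ h , f-mono ∘ h-mono

Extends : List A → Pred (List A) 0ℓ
Extends v x = ∃ λ w → x ≡ v ++ w

length-∷ʳ : (v : List A) → ∀ a → length (v ∷ʳ a) ≡ suc (length v)
length-∷ʳ v a = trans (length-++ v) (ℕ.+-comm (length v) 1)

extends-split : (v : List A) → Extends v ⊆ (_≡ v) ∪ ⋃[ a ∶ A ] Extends (v ∷ʳ a)
extends-split v ([]    , refl) = inj₁ (++-identityʳ v)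
extends-split v (a ∷ w , refl) = inj₂ (a , w , sym (∷ʳ-++ v a w))

-- The label of x plays the role of the height of {y ∈ X : y < x}, an ordinal below ωⁿ.
record RelativeRanking (_<_ : Rel A 0ℓ) (X : Pred A 0ℓ) (n : ℕ) : Set where
  field
    label  : A → Vec ℕ n
    mono   : ∀ {x y} → y < x → label y ≼ label x
    strict : ∀ {x y} → X y → y < x → label y ≺ label x

open RelativeRanking

module _ {_<_ : Rel A 0ℓ} where

  relativeRanking-⊆ : {X Y : Pred A 0ℓ} → X ⊆ Y →
    RelativeRanking _<_ Y n → RelativeRanking _<_ X n
  relativeRanking-⊆ X⊆Y r = record { label = label r ; mono = mono r ; strict = strict r ∘ X⊆Y }

  relativeRanking-∅ : RelativeRanking _<_ ∅ n
  relativeRanking-∅ = record { label = λ _ → 𝟎 ; mono = λ _ → ≼.refl ; strict = λ () }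

  relativeRanking-∪ : {X Y : Pred A 0ℓ} →
    RelativeRanking _<_ X n → RelativeRanking _<_ Y n → RelativeRanking _<_ (X ∪ Y) n
  relativeRanking-∪ {X = X} {Y} r s = record
    { label  = λ x → label r x ⊞ label s x
    ; mono   = λ y<x → ≼.trans (⊞-monoˡ-≼ _ (mono r y<x)) (⊞-monoʳ-≼ _ (mono s y<x))
    ; strict = λ where
        (inj₁ y∈X) y<x → ≺-≼-trans (⊞-monoˡ-≺ _ (strict r y∈X y<x)) (⊞-monoʳ-≼ _ (mono s y<x))
        (inj₂ y∈Y) y<x → ≼-≺-trans (⊞-monoˡ-≼ _ (mono r y<x)) (⊞-monoʳ-≺ _ (strict s y∈Y y<x))
    }

  relativeRanking-⋃ : {X : Fin m → Pred A 0ℓ} →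
    (∀ i → RelativeRanking _<_ (X i) n) → RelativeRanking _<_ (⋃ (Fin m) X) n
  relativeRanking-⋃ {m = zero}  _ = relativeRanking-⊆ (λ ()) relativeRanking-∅
  relativeRanking-⋃ {m = suc m} r =
    relativeRanking-⊆ (λ where (zero  , x∈) → inj₁ x∈
                               (suc i , x∈) → inj₂ (i , x∈))
      (relativeRanking-∪ (r zero) (relativeRanking-⋃ (r ∘ suc)))

  relativeRanking-prefixes : {X : Pred A 0ℓ} (word : A → List (Fin k)) →
    (∀ v → RelativeRanking _<_ (X ∩ ((_≡ v) ∘ word)) n) →
    ∀ m → (∀ v → length v ≡ m → RelativeRanking _<_ (X ∩ (Extends v ∘ word)) n) →
    RelativeRanking _<_ X n
  relativeRanking-prefixes {k} {n} {X} word singleton m extensions =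
    relativeRanking-⊆ (λ x∈X → x∈X , _ , refl) (go m [] (ℕ.+-identityʳ m))
    where
    split : ∀ v → X ∩ (Extends v ∘ word) ⊆
                  (X ∩ ((_≡ v) ∘ word)) ∪ ⋃[ a ∶ Fin k ] (X ∩ (Extends (v ∷ʳ a) ∘ word))
    split v (x∈X , v-prefix) =
      Sum.map (x∈X ,_) (λ (a , va-prefix) → a , x∈X , va-prefix) (extends-split v v-prefix)

    go : ∀ j v → j + length v ≡ m → RelativeRanking _<_ (X ∩ (Extends v ∘ word)) n
    go zero    v |v|≡m     = extensions v |v|≡m
    go (suc j) v 1+j+|v|≡m =
      relativeRanking-⊆ (split v)
        (relativeRanking-∪ (singleton v) (relativeRanking-⋃ λ a → go j (v ∷ʳ a) (begin
          j + length (v ∷ʳ a)  ≡⟨ cong (j +_) (length-∷ʳ v a) ⟩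
          j + suc (length v)   ≡⟨ ℕ.+-suc j (length v) ⟩
          suc j + length v     ≡⟨ 1+j+|v|≡m ⟩
          m                    ∎)))

module Classical (em : ExcludedMiddle 0ℓ) where

  ≰ₒ⇒>ₒ : ∀ α β → ¬ α ≤ₒ β → β <ₒ α
  ≰ₒ⇒>ₒ (sup I f) (sup J g) α≰β = decidable-stable em λ β≮α →
    α≰β λ i → decidable-stable em λ fi≮β →
      β≮α (i , λ j → ≰ₒ⇒>ₒ (f i) (g j) λ fi≤gj → fi≮β (j , fi≤gj))

  minimal : {_<_ : Rel A 0ℓ} → WellFounded _<_ → {P : Pred A 0ℓ} →
    ∃ P → ∃ λ x → P x × (∀ {y} → y < x → ¬ P y)
  minimal {_<_ = _<_} wf {P} (x , x∈P) = go (wf x) x∈P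
    where
    go : ∀ {x} → Acc _<_ x → P x → ∃ λ x → P x × (∀ {y} → y < x → ¬ P y)
    go {x} (acc rs) x∈P with em {∃ λ y → y < x × P y}
    ... | yes (_ , y<x , y∈P) = go (rs y<x) y∈P
    ... | no ∄y               = x , x∈P , λ y<x y∈P → ∄y (_ , y<x , y∈P)

  cantorNormalForm : α <ₒ ω^ n → ∃ λ (v : Vec ℕ n) → α ≈ₒ ⟦ v ⟧
  cantorNormalForm {α} α<ω^n with minimal ≺-wellFounded {λ v → α ≤ₒ ⟦ v ⟧} (ω^-cofinal α<ω^n)
  ... | v , α≤v , least = v , α≤v , below⇒≤ₒ λ β<v →
    let u , u≺v , β≤u = ⟦⟧-cofinal v β<v
    in  ≤ₒ-<ₒ-trans β≤u (≰ₒ⇒>ₒ α ⟦ u ⟧ (least u≺v))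

  normalForm : α <ₒ ω^ n → Vec ℕ n
  normalForm α<ω^n = proj₁ (cantorNormalForm α<ω^n)

  normalForm-≈ : (p : α <ₒ ω^ n) → α ≈ₒ ⟦ normalForm p ⟧
  normalForm-≈ α<ω^n = proj₂ (cantorNormalForm α<ω^n)

  normalForm-mono-< : (p : α <ₒ ω^ n) (q : β <ₒ ω^ n) → α <ₒ β → normalForm p ≺ normalForm q
  normalForm-mono-< p q α<β =
    ⟦⟧-cancel-≺ (≤ₒ-<ₒ-trans (proj₂ (normalForm-≈ p))
      (<ₒ-≤ₒ-trans α<β (proj₁ (normalForm-≈ q))))

  normalForm-mono-≤ : (p : α <ₒ ω^ n) (q : β <ₒ ω^ n) → α ≤ₒ β → normalForm p ≼ normalForm q
  normalForm-mono-≤ p q α≤β =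
    ⟦⟧-cancel-≼ (≤ₒ-trans (proj₂ (normalForm-≈ p))
      (≤ₒ-trans α≤β (proj₁ (normalForm-≈ q))))

  rank<ω^⇒ranking : {_<_ : Rel A 0ℓ} (wf : WellFounded _<_) {X : Pred A 0ℓ} →
    (∀ {x} → X x → Height.rank _<_ wf x <ₒ ω^ n) → Ranking {∃ X} (_<_ on proj₁) n
  rank<ω^⇒ranking wf bound =
    (λ (_ , x∈X) → normalForm (bound x∈X)) ,
    λ {(_ , y∈X)} {(_ , x∈X)} y<x → normalForm-mono-< (bound y∈X) (bound x∈X) (rank-mono-< y<x)
    where open RankProperties wf

  module TransitiveRanking {_<_ : Rel A 0ℓ} (<-trans : Transitive _<_) where

    ranking⇒relativeRanking : {X : Pred A 0ℓ} →
      Ranking {∃ X} (_<_ on proj₁) n → RelativeRanking _<_ X (suc n)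
    ranking⇒relativeRanking {n} {X} (f , f-mono) = record
      { label  = normalForm ∘ height<ω^
      ; mono   = λ y<x → normalForm-mono-≤ (height<ω^ _) (height<ω^ _)
          λ (z , z<y) → (z , <-trans z<y y<x) , ≤ₒ-refl ⟦ f z ⟧
      ; strict = λ y∈X y<x → normalForm-mono-< (height<ω^ _) (height<ω^ _)
          (((_ , y∈X) , y<x) , λ (_ , z<y) → ⟦⟧-mono-≺ (f-mono z<y))
      }
      where
      heightBelow : A → Ord
      heightBelow x = sup (∃ λ (y : ∃ X) → proj₁ y < x) (⟦_⟧ ∘ f ∘ proj₁)

      height<ω^ : ∀ x → heightBelow x <ₒ ω^ (suc n)
      height<ω^ x = ≤ω^⇒<ω^suc n λ (y , _) → ⟦⟧<ω^ (f y)

    antichain⇒relativeRanking : {X : Pred A 0ℓ} →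
      (∀ {x y} → X x → X y → ¬ y < x) → RelativeRanking _<_ X (suc n)
    antichain⇒relativeRanking antichain = ranking⇒relativeRanking
      ((λ _ → 𝟎) , λ {(_ , y∈X)} {(_ , x∈X)} y<x → contradiction y<x (antichain x∈X y∈X))

    rank≤relativeRanking : (wf : WellFounded _<_) →
      ∀ {x} (r : RelativeRanking _<_ (_< x) n) → Height.rank _<_ wf x ≤ₒ ⟦ label r x ⟧
    rank≤relativeRanking wf {x} r =
      rank≤labelling {φ = ⟦_⟧ ∘ label r} {X = λ y → ∀ {z} → z < y → z < x}
        (λ y↓⊆x↓ z<y t<z → y↓⊆x↓ (<-trans t<z z<y))
        (λ y↓⊆x↓ z<y → ⟦⟧-mono-≺ (strict r (y↓⊆x↓ z<y) z<y))
        id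
      where open RankProperties wf

  finite-uniform-bound : (xs : List A) (P : A → Pred ℕ 0ℓ) → (∀ {x} → P x Respects _≤_) →
    ∃ λ M → ∀ {x} → x ∈ xs → ∃ (P x) → P x M
  finite-uniform-bound {A} xs P monotone =
    max 0 (List.map bound xs) , λ x∈xs ∃P → monotone (bound≤max x∈xs) (bounds _ ∃P)
    where
    locally : ∀ x → ∃ λ m → ∃ (P x) → P x m
    locally x with em {∃ (P x)}
    ... | yes (m , p) = m , λ _ → p
    ... | no ∄        = 0 , λ ∃P → contradiction ∃P ∄

    bound : A → ℕ
    bound x = proj₁ (locally x)

    bounds : ∀ x → ∃ (P x) → P x (bound x)
    bounds x = proj₂ (locally x)

    bound≤max : ∀ {x} → x ∈ xs → bound x ≤ max 0 (List.map bound xs)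
    bound≤max = All.lookup (All.map⁻ (xs≤max 0 (List.map bound xs)))

run : (D : DFA A) → Fin (DFA.nStates D) → List A → Fin (DFA.nStates D)
run D = foldl (DFA.δ D)

AcceptsFrom : (D : DFA A) → Fin (DFA.nStates D) → Pred (List A) 0ℓ
AcceptsFrom D q w = DFA.final D (run D q w) ≡ true

acceptsFrom-++ : (D : DFA A) → ∀ q u w → AcceptsFrom D q (u ++ w) ⇔ AcceptsFrom D (run D q u) w
acceptsFrom-++ D q u w rewrite foldl-++ (DFA.δ D) q u w = ⇔-id _

record Regular (L : Pred (List A) 0ℓ) : Set where
  field
    dfa      : DFA A
    accepts⇔ : ∀ w → Accepts dfa w ⇔ L w

record Regular₂ (R : Rel (List (Fin k)) 0ℓ) : Set where
  field
    dfa      : DFA (Padded k × Padded k)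
    accepts⇔ : ∀ u v → Accepts dfa (conv u v) ⇔ R u v

regular-resp-⇔ : {L M : Pred (List A) 0ℓ} → (∀ w → L w ⇔ M w) → Regular L → Regular M
regular-resp-⇔ L⇔M r = record { dfa = dfa ; accepts⇔ = λ w → L⇔M w ⇔-∘ accepts⇔ w }
  where open Regular r

does⇔ : (P? : Dec A) → does P? ≡ true ⇔ A
does⇔ (yes p) = mk⇔ (λ _ → p) (λ _ → refl)
does⇔ (no ¬p) = mk⇔ (λ ()) (λ p → contradiction p ¬p)

module FiniteSubautomaton (step : Q → A → Q) {F : Pred Q 0ℓ} (F? : Decidable F)
  {qs : List Q} (closed : ∀ {q} a → q ∈ qs → step q a ∈ qs) where

  automaton : ∀ {q} → q ∈ qs → DFA A
  automaton q∈qs = record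
    { nStates = length qs
    ; start   = Any.index q∈qs
    ; δ       = λ i a → Any.index (closed a (∈-lookup i))
    ; final   = λ i → does (F? (List.lookup qs i))
    }

  lookup-run : ∀ {q} (q∈qs : q ∈ qs) i w →
    List.lookup qs (run (automaton q∈qs) i w) ≡ foldl step (List.lookup qs i) w
  lookup-run q∈qs i []      = refl
  lookup-run q∈qs i (a ∷ w) = begin
    List.lookup qs (run (automaton q∈qs) j w)  ≡⟨ lookup-run q∈qs j w ⟩
    foldl step (List.lookup qs j) w            ≡⟨ cong (λ q → foldl step q w) lookup-j ⟩
    foldl step (step (List.lookup qs i) a) w   ∎
    where
    j : Fin (length qs)
    j = Any.index (closed a (∈-lookup i))

    lookup-j : List.lookup qs j ≡ step (List.lookup qs i) a
    lookup-j = sym (Any.lookup-index (closed a (∈-lookup i)))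

  accepts-automaton⇔ : ∀ {q} (q∈qs : q ∈ qs) w → Accepts (automaton q∈qs) w ⇔ F (foldl step q w)
  accepts-automaton⇔ {q} q∈qs w =
    subst (λ q → Accepts (automaton q∈qs) w ⇔ F q) final-state (does⇔ (F? _))
    where
    final-state : List.lookup qs (run (automaton q∈qs) (Any.index q∈qs) w) ≡ foldl step q w
    final-state = begin
      List.lookup qs (run (automaton q∈qs) (Any.index q∈qs) w)  ≡⟨ lookup-run q∈qs _ w ⟩
      foldl step (List.lookup qs (Any.index q∈qs)) w            ≡⟨ cong (λ q → foldl step q w)
                                                                     (Any.lookup-index q∈qs) ⟨
      foldl step q w                                            ∎

quotients⇒regular : (step : Q → A → Q) {qs : List Q} → (∀ {q} a → q ∈ qs → step q a ∈ qs) →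
  (L : Q → Pred (List A) 0ℓ) → (∀ q → Dec (L q [])) → (∀ q a w → L (step q a) w ⇔ L q (a ∷ w)) →
  ∀ {q} → q ∈ qs → Regular (L q)
quotients⇒regular step closed L nullable? quotient q∈qs = record
  { dfa      = automaton q∈qs
  ; accepts⇔ = λ w → foldl-quotient _ w ⇔-∘ accepts-automaton⇔ q∈qs w
  }
  where
  open FiniteSubautomaton step nullable? closed

  foldl-quotient : ∀ q w → L (foldl step q w) [] ⇔ L q w
  foldl-quotient q []      = ⇔-id _
  foldl-quotient q (a ∷ w) = quotient q a w ⇔-∘ foldl-quotient (step q a) w

-- The quotient condition at u = v = [] concerns the letter (nothing , nothing), which occurs in no
-- convolution.
quotients⇒regular₂ : (step : Q → Padded k × Padded k → Q) {qs : List Q} →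
  (∀ {q} ab → q ∈ qs → step q ab ∈ qs) →
  (R : Q → Rel (List (Fin k)) 0ℓ) → (∀ q → Dec (R q [] [])) →
  (∀ q u v → R (step q (head u , head v)) (drop 1 u) (drop 1 v) ⇔ R q u v) →
  ∀ {q} → q ∈ qs → Regular₂ (R q)
quotients⇒regular₂ step closed R nullable? quotient q∈qs = record
  { dfa      = automaton q∈qs
  ; accepts⇔ = λ u v → foldl-quotient _ u v ⇔-∘ accepts-automaton⇔ q∈qs (conv u v)
  }
  where
  open FiniteSubautomaton step nullable? closed

  foldl-quotient : ∀ q u v → R (foldl step q (conv u v)) [] [] ⇔ R q u v
  foldl-quotient q []      []      = ⇔-id _
  foldl-quotient q (a ∷ u) []      = quotient q (a ∷ u) [] ⇔-∘ foldl-quotient _ u []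
  foldl-quotient q []      (b ∷ v) = quotient q [] (b ∷ v) ⇔-∘ foldl-quotient _ [] v
  foldl-quotient q (a ∷ u) (b ∷ v) = quotient q (a ∷ u) (b ∷ v) ⇔-∘ foldl-quotient _ u v

∩-regular : {L M : Pred (List A) 0ℓ} → Regular L → Regular M → Regular (L ∩ M)
∩-regular r s =
  regular-resp-⇔ (λ w → R.accepts⇔ w ×-⇔ S.accepts⇔ w)
    (quotients⇒regular (λ (p , q) a → D.δ p a , E.δ q a)
      (λ _ _ → ∈-cartesianProduct⁺ (∈-allFin _) (∈-allFin _))
      (λ (p , q) w → AcceptsFrom R.dfa p w × AcceptsFrom S.dfa q w)
      (λ (p , q) → (D.final p Bool.≟ true) ×-dec (E.final q Bool.≟ true))
      (λ _ _ _ → ⇔-id _)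
      (∈-cartesianProduct⁺ (∈-allFin D.start) (∈-allFin E.start)))
  where
  module R = Regular r
  module S = Regular s
  module D = DFA R.dfa
  module E = DFA S.dfa

∈-tails : (v : List A) → v ∈ tails v
∈-tails []      = here refl
∈-tails (_ ∷ _) = here refl

drop₁-∈-tails : ∀ {t} (v : List A) → t ∈ tails v → drop 1 t ∈ tails v
drop₁-∈-tails []      (here refl) = here refl
drop₁-∈-tails (_ ∷ v) (here refl) = there (∈-tails v)
drop₁-∈-tails (_ ∷ v) (there t∈)  = there (drop₁-∈-tails v t∈)

section-regular : {R : Rel (List (Fin k)) 0ℓ} → Regular₂ R → ∀ v → Regular (λ w → R w v)
section-regular r v =
  regular-resp-⇔ (λ w → accepts⇔ w v)
    (quotients⇒regular (λ (q , t) a → δ q (just a , head t) , drop 1 t)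
      (λ a qt∈ → ∈-cartesianProduct⁺ (∈-allFin _)
                   (drop₁-∈-tails v (proj₂ (∈-cartesianProduct⁻ (allFin nStates) (tails v) qt∈))))
      (λ (q , t) w → AcceptsFrom dfa q (conv w t))
      (λ (q , t) → final (run dfa q (conv [] t)) Bool.≟ true)
      quotient
      (∈-cartesianProduct⁺ (∈-allFin start) (∈-tails v)))
  where
  open Regular₂ r
  open DFA dfa

  quotient : ∀ qt a w → let (q , t) = qt in
    AcceptsFrom dfa (δ q (just a , head t)) (conv w (drop 1 t)) ⇔
    AcceptsFrom dfa q (conv (a ∷ w) t)
  quotient (q , [])    a w = ⇔-id _
  quotient (q , _ ∷ _) a w = ⇔-id _

infix 4 _⊑_

_⊑_ : Rel (List (Fin k)) 0ℓ
_⊑_ = ListLex.Lex-≤ _≡_ Fin._<_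

data Comparison : Set where
  equal less greater : Comparison

lexStep : Comparison → Padded k × Padded k → Comparison
lexStep less    _                  = less
lexStep greater _                  = greater
lexStep equal   (nothing , _)      = less
lexStep equal   (just _ , nothing) = greater
lexStep equal   (just a , just b)  with Fin.<-cmp a b
... | tri< _ _ _ = less
... | tri≈ _ _ _ = equal
... | tri> _ _ _ = greater

LexFrom : Comparison → Rel (List (Fin k)) 0ℓ
LexFrom equal   = _⊑_
LexFrom less    = λ _ _ → ⊤
LexFrom greater = λ _ _ → ⊥

[]⊑ : (v : List (Fin k)) → [] ⊑ v
[]⊑ []      = base tt
[]⊑ (_ ∷ _) = halt

lexFrom-quotient : ∀ c (u v : List (Fin k)) →
  LexFrom (lexStep c (head u , head v)) (drop 1 u) (drop 1 v) ⇔ LexFrom c u v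
lexFrom-quotient less    _       _       = ⇔-id _
lexFrom-quotient greater _       _       = ⇔-id _
lexFrom-quotient equal   []      v       = mk⇔ (λ _ → []⊑ v) _
lexFrom-quotient equal   (_ ∷ _) []      = mk⇔ ⊥-elim (λ ())
lexFrom-quotient equal   (a ∷ u) (b ∷ v) with Fin.<-cmp a b
... | tri< a<b _ _    = mk⇔ (λ _ → this a<b) _
... | tri≈ a≮a refl _ = mk⇔ (next refl) λ where
                          (this a<a)   → contradiction a<a a≮a
                          (next _ u⊑v) → u⊑v
... | tri> a≮b a≢b _  = mk⇔ ⊥-elim (ListLex.¬≤-this a≢b a≮b)

⊑-regular₂ : Regular₂ (_⊑_ {k})
⊑-regular₂ = quotients⇒regular₂ lexStep (λ _ _ → ∈-comparisons _) LexFrom nullable?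
  lexFrom-quotient (∈-comparisons equal)
  where
  ∈-comparisons : ∀ c → c ∈ equal ∷ less ∷ greater ∷ []
  ∈-comparisons equal   = here refl
  ∈-comparisons less    = there (here refl)
  ∈-comparisons greater = there (there (here refl))

  nullable? : ∀ c → Dec (LexFrom c [] [])
  nullable? equal   = yes (base tt)
  nullable? less    = yes tt
  nullable? greater = no λ ()

length<⇒++-≢ : {u v : List A} → length u < length v → ∀ w → v ++ w ≢ u
length<⇒++-≢ {v = v} |u|<|v| w refl =
  ℕ.<⇒≱ |u|<|v| (subst (length v ≤_) (sym (length-++ v)) (ℕ.m≤m+n (length v) (length w)))

conv-++ : (u v : List (Fin k)) → length u ≡ length v → ∀ w x →
  conv (u ++ w) (v ++ x) ≡ conv u v ++ conv w x
conv-++ []      []      _  w x = refl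
conv-++ (_ ∷ u) (_ ∷ v) eq w x = cong (_ ∷_) (conv-++ u v (ℕ.suc-injective eq) w x)

conv-++ˡ : (u v : List (Fin k)) → length v ≤ length u → ∀ w →
  conv (u ++ w) v ≡ conv u v ++ conv w []
conv-++ˡ []      []      _       w = refl
conv-++ˡ (_ ∷ u) []      _       w = cong (_ ∷_) (conv-++ˡ u [] z≤n w)
conv-++ˡ (_ ∷ u) (_ ∷ v) (s≤s p) w = cong (_ ∷_) (conv-++ˡ u v p w)

module UpperBound (em : ExcludedMiddle 0ℓ) (P : AutomaticWFPO) where

  open Classical em
  open AutomaticWFPO P renaming (_<_ to _<P_; _≤_ to _≤P_; k to |Σ|)
  open Height _<P_ wf< using (rank)

  <P-trans : ∀ {x y z} → x <P y → y <P z → x <P z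
  <P-trans {x} {y} {z} (x≤y , x≢y) (y≤z , _) = trans≤ x y z x≤y y≤z , λ x≡z →
    x≢y (antisym≤ x y x≤y (subst (λ w → Accepts Ord≤ (conv (proj₁ y) w)) (sym x≡z) y≤z))

  open TransitiveRanking {_<_ = _<P_} (λ {x} {y} {z} → <P-trans {x} {y} {z})

  Word : Set
  Word = List (Fin |Σ|)

  DomState OrdState : Set
  DomState = Fin (DFA.nStates Dom)
  OrdState = Fin (DFA.nStates Ord≤)

  -- The words v w < u with |v| = |u| + 1 form a suborder that depends only on the states
  -- reached after reading v, (v , u) and (v , v).
  Piece : DomState → OrdState → Set
  Piece p q = ∃ λ w → AcceptsFrom Dom p w × AcceptsFrom Ord≤ q (conv w [])

  PieceOrder : ∀ p q → OrdState → Rel (Piece p q) 0ℓ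
  PieceOrder p q r (w , _) (x , _) = AcceptsFrom Ord≤ r (conv w x) × w ≢ x

  UniformlyRanked : ℕ → Set
  UniformlyRanked M = ∀ p q r → ∃ (Ranking (PieceOrder p q r)) → Ranking (PieceOrder p q r) M

  pieces-uniformlyRanked : ∃ UniformlyRanked
  pieces-uniformlyRanked =
    let M , ranked = finite-uniform-bound
          (cartesianProduct (allFin _) (cartesianProduct (allFin _) (allFin _)))
          (λ (p , q , r) → Ranking (PieceOrder p q r))
          (λ { {p , q , r} → suc-closed⇒respects-≤ (ranking-suc {_<_ = PieceOrder p q r}) })
    in  M , λ p q r → ranked
          (∈-cartesianProduct⁺ (∈-allFin p) (∈-cartesianProduct⁺ (∈-allFin q) (∈-allFin r)))

  module Prefix (u : Carrier) (v : Word) (|u|<|v| : length (proj₁ u) < length v) where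

    [v] : DomState
    [v] = run Dom (DFA.start Dom) v

    [v,u] [v,v] : OrdState
    [v,u] = run Ord≤ (DFA.start Ord≤) (conv v (proj₁ u))
    [v,v] = run Ord≤ (DFA.start Ord≤) (conv v v)

    Extension : Pred Carrier 0ℓ
    Extension = (_<P u) ∩ (Extends v ∘ proj₁)

    dom-++⇔ : ∀ w → Accepts Dom (v ++ w) ⇔ AcceptsFrom Dom [v] w
    dom-++⇔ = acceptsFrom-++ Dom _ v

    ++≤u⇔ : ∀ w → Accepts Ord≤ (conv (v ++ w) (proj₁ u)) ⇔ AcceptsFrom Ord≤ [v,u] (conv w [])
    ++≤u⇔ w rewrite conv-++ˡ v (proj₁ u) (ℕ.<⇒≤ |u|<|v|) w =
      acceptsFrom-++ Ord≤ _ (conv v (proj₁ u)) (conv w [])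

    ++≤++⇔ : ∀ w x → Accepts Ord≤ (conv (v ++ w) (v ++ x)) ⇔ AcceptsFrom Ord≤ [v,v] (conv w x)
    ++≤++⇔ w x rewrite conv-++ v v refl w x = acceptsFrom-++ Ord≤ _ (conv v v) (conv w x)

    fromPiece : Piece [v] [v,u] → ∃ (_<P u)
    fromPiece (w , w∈ , w≤) =
      (v ++ w , from (dom-++⇔ w) w∈) , from (++≤u⇔ w) w≤ , length<⇒++-≢ |u|<|v| w

    fromPiece-mono : fromPiece Preserves PieceOrder [v] [v,u] [v,v] ⟶ (_<P_ on proj₁)
    fromPiece-mono {w , _} {x , _} (w≤x , w≢x) = from (++≤++⇔ w x) w≤x , w≢x ∘ ++-cancelˡ v w x

    toPiece : ∃ Extension → Piece [v] [v,u]
    toPiece ((_ , x∈) , (x≤u , _) , w , refl) = w , to (dom-++⇔ w) x∈ , to (++≤u⇔ w) x≤u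

    toPiece-mono : toPiece Preserves (_<P_ on proj₁) ⟶ PieceOrder [v] [v,u] [v,v]
    toPiece-mono {_ , _ , w , refl} {_ , _ , x , refl} (w≤x , w≢x) =
      to (++≤++⇔ w x) w≤x , w≢x ∘ cong (v ++_)

    ranking-piece : (∀ {y} → y <P u → rank y <ₒ ω^ n) → Ranking (PieceOrder [v] [v,u] [v,v]) n
    ranking-piece below<ω^n =
      ranking-∘ {_<₂_ = _<P_ on proj₁} fromPiece (λ {w} {x} → fromPiece-mono {w} {x})
        (rank<ω^⇒ranking wf< (λ {y} → below<ω^n {y}))

    relativeRanking-extension : Ranking (PieceOrder [v] [v,u] [v,v]) n →
      RelativeRanking _<P_ Extension (suc n)
    relativeRanking-extension = ranking⇒relativeRanking ∘
      ranking-∘ {_<₂_ = PieceOrder [v] [v,u] [v,v]} toPiece (λ {x} {y} → toPiece-mono {x} {y})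

  relativeRanking-below : ∀ {M} → UniformlyRanked M →
    ∀ u → (∀ {y} → y <P u → rank y <ₒ ω^ (suc M)) →
    RelativeRanking _<P_ (_<P u) (suc M)
  relativeRanking-below {M} ranked u below<ω^ =
    relativeRanking-prefixes proj₁ singleton (suc (length (proj₁ u))) extension
    where
    singleton : ∀ v → RelativeRanking _<P_ ((_<P u) ∩ ((_≡ v) ∘ proj₁)) (suc M)
    singleton v = antichain⇒relativeRanking
      λ (_ , x≡v) (_ , y≡v) (_ , y≢x) → y≢x (trans y≡v (sym x≡v))

    extension : ∀ v → length v ≡ suc (length (proj₁ u)) →
      RelativeRanking _<P_ ((_<P u) ∩ (Extends v ∘ proj₁)) (suc M)
    extension v |v|≡1+|u| =
      relativeRanking-extension (ranked _ _ _ (suc M , ranking-piece (λ {y} → below<ω^ {y})))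
      where open Prefix u v (ℕ.≤-reflexive (sym |v|≡1+|u|))

  rank<ω^ : ∀ {M} → UniformlyRanked M → ∀ u → Acc _<P_ u → rank u <ₒ ω^ (suc M)
  rank<ω^ {M} ranked u (acc rs) =
    ≤ₒ-<ₒ-trans (rank≤relativeRanking wf< {u} ranking) (⟦⟧<ω^ (label ranking u))
    where
    ranking : RelativeRanking _<P_ (_<P u) (suc M)
    ranking = relativeRanking-below ranked u λ {y} y<u → rank<ω^ ranked y (rs y<u)

  height<ω^ω : height <ₒ ω^ω
  height<ω^ω = let M , ranked = pieces-uniformlyRanked in
    suc M , λ (_ , y , _) → rank<ω^ ranked y (wf< y)

Image : (A → B) → Pred B 0ℓ
Image f y = ∃ λ x → f x ≡ y

module InitialSegment {code : Vec ℕ n → List (Fin k)} {_⊑_ : Rel (List (Fin k)) 0ℓ}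
  (image : Regular (Image code)) (order : Regular₂ _⊑_)
  (code-⊑⇔≼ : ∀ u v → code u ⊑ code v ⇔ u ≼ v) (d : Vec ℕ n) where

  abstract
    domain : Regular (Image code ∩ (_⊑ code d))
    domain = ∩-regular image (section-regular order (code d))

  module Domain = Regular domain
  module Order = Regular₂ order

  Element : Set
  Element = ∃ (Accepts Domain.dfa)

  infix 4 _≤ₑ_ _<ₑ_

  _≤ₑ_ _<ₑ_ : Rel Element 0ℓ
  x ≤ₑ y = Accepts Order.dfa (conv (proj₁ x) (proj₁ y))
  x <ₑ y = x ≤ₑ y × proj₁ x ≢ proj₁ y

  value : Element → Vec ℕ n
  value (w , w∈) = proj₁ (proj₁ (to (Domain.accepts⇔ w) w∈))

  code-value : ∀ x → code (value x) ≡ proj₁ x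
  code-value (w , w∈) = proj₂ (proj₁ (to (Domain.accepts⇔ w) w∈))

  ≤ₑ⇔value≼ : ∀ x y → x ≤ₑ y ⇔ value x ≼ value y
  ≤ₑ⇔value≼ x y = code-⊑⇔≼ (value x) (value y) ⇔-∘
    subst₂ (λ u v → x ≤ₑ y ⇔ u ⊑ v) (sym (code-value x)) (sym (code-value y)) (Order.accepts⇔ _ _)

  code-injective : ∀ {u v} → code u ≡ code v → u ≡ v
  code-injective {u} {v} eq = ≼.antisym
    (to (code-⊑⇔≼ u v) (subst (code u ⊑_) eq (from (code-⊑⇔≼ u u) ≼.refl)))
    (to (code-⊑⇔≼ v u) (subst (code v ⊑_) (sym eq) (from (code-⊑⇔≼ v v) ≼.refl)))

  value-injective : ∀ x y → value x ≡ value y → proj₁ x ≡ proj₁ y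
  value-injective x y eq = trans (sym (code-value x)) (trans (cong code eq) (code-value y))

  value-cong : ∀ x y → proj₁ x ≡ proj₁ y → value x ≡ value y
  value-cong x y eq = code-injective (trans (code-value x) (trans eq (sym (code-value y))))

  value-mono-< : value Preserves _<ₑ_ ⟶ _≺_
  value-mono-< {x} {y} (x≤y , x≢y) with to (≤ₑ⇔value≼ x y) x≤y
  ... | inj₁ x≺y = x≺y
  ... | inj₂ x≡y = contradiction (value-injective x y x≡y) x≢y

  value-cancel-< : ∀ x y → value x ≺ value y → x <ₑ y
  value-cancel-< x y x≺y =
    from (≤ₑ⇔value≼ x y) (inj₁ x≺y) , λ x≡y → ≺.irrefl (value-cong x y x≡y) x≺y

  value≼d : ∀ x → value x ≼ d
  value≼d x@(w , w∈) = to (code-⊑⇔≼ (value x) d)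
    (subst (_⊑ code d) (sym (code-value x)) (proj₂ (to (Domain.accepts⇔ w) w∈)))

  value-onto : ∀ {v} → v ≼ d → ∃ λ x → value x ≡ v
  value-onto {v} v≼d = x , code-injective (code-value x)
    where
    x : Element
    x = code v , from (Domain.accepts⇔ (code v)) ((v , refl) , from (code-⊑⇔≼ v d) v≼d)

  <ₑ-wellFounded : WellFounded _<ₑ_
  <ₑ-wellFounded = Subrelation.wellFounded (λ {x} {y} → value-mono-< {x} {y})
    (On.wellFounded value ≺-wellFounded)

  segment : AutomaticWFPO
  segment = record
    { k        = k
    ; Dom      = Domain.dfa
    ; Ord≤     = Order.dfa
    ; refl≤    = λ x → from (≤ₑ⇔value≼ x x) ≼.refl
    ; antisym≤ = λ x y x≤y y≤x → value-injective x y
        (≼.antisym (to (≤ₑ⇔value≼ x y) x≤y) (to (≤ₑ⇔value≼ y x) y≤x))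
    ; trans≤   = λ x y z x≤y y≤z → from (≤ₑ⇔value≼ x z)
        (≼.trans (to (≤ₑ⇔value≼ x y) x≤y) (to (≤ₑ⇔value≼ y z) y≤z))
    ; wf<      = <ₑ-wellFounded
    }

  open Height _<ₑ_ <ₑ-wellFounded using (rank)
  open RankProperties <ₑ-wellFounded

  rank≈⟦value⟧ : ∀ x → rank x ≈ₒ ⟦ value x ⟧
  rank≈⟦value⟧ x =
    rank≤labelling {φ = ⟦_⟧ ∘ value} {X = U} _ strict-value _ , labelling≤rank cofinal x
    where
    strict-value : ∀ {x y} → U x → y <ₑ x → ⟦ value y ⟧ <ₒ ⟦ value x ⟧
    strict-value {x} {y} _ = ⟦⟧-mono-≺ ∘ value-mono-< {y} {x}

    cofinal : ∀ x {β} → β <ₒ ⟦ value x ⟧ → ∃ λ y → y <ₑ x × β ≤ₒ ⟦ value y ⟧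
    cofinal x β<x with ⟦⟧-cofinal (value x) β<x
    ... | v , v≺x , β≤v with value-onto (inj₁ (≺-≼-trans v≺x (value≼d x)))
    ...   | y , refl = y , value-cancel-< y x v≺x , β≤v

  height≈⟦d⟧ : AutomaticWFPO.height segment ≈ₒ ⟦ d ⟧
  height≈⟦d⟧ with value-onto ≼.refl
  ... | t , t≡d = ≈ₒ-trans
    (height≈rank λ {x} {y} y<x → value-cancel-< y t
      (≺-≼-trans (value-mono-< {y} {x} y<x) (subst (value x ≼_) (sym t≡d) (value≼d x))))
    (subst (λ v → rank t ≈ₒ ⟦ v ⟧) t≡d (rank≈⟦value⟧ t))

-- The closing 0F of each coordinate makes the code prefix-free, so the lexicographic order on
-- codewords is that of the coded vectors.
encode : Vec ℕ n → List (Fin 2)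
encode []          = []
encode (zero ∷ v)  = 0F ∷ encode v
encode (suc a ∷ v) = 1F ∷ encode (a ∷ v)

suc-head-≺ : {u v : Vec ℕ n} → a ∷ u ≺ b ∷ v → suc a ∷ u ≺ suc b ∷ v
suc-head-≺ (this a<b eq)   = this (s<s a<b) eq
suc-head-≺ (next refl u≺v) = next refl u≺v

encode-mono-≺ : {u v : Vec ℕ n} → u ≺ v → encode u ⊑ encode v
encode-mono-≺ {u = zero ∷ _}  {suc _ ∷ _} (this _ _)          = this z<s
encode-mono-≺ {u = suc _ ∷ _} {suc _ ∷ _} (this (s<s a<b) eq) =
  next refl (encode-mono-≺ (this a<b eq))
encode-mono-≺ {u = zero ∷ _}              (next refl u≺v)     = next refl (encode-mono-≺ u≺v)
encode-mono-≺ {u = suc a ∷ u} {suc a ∷ v} (next refl u≺v)     =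
  next refl (encode-mono-≺ {u = a ∷ u} {a ∷ v} (next refl u≺v))

⊑-refl : (w : List (Fin k)) → w ⊑ w
⊑-refl w = ListLex.≤-reflexive _≡_ Fin._<_ (ListPointwise.refl refl)

encode-mono-≼ : {u v : Vec ℕ n} → u ≼ v → encode u ⊑ encode v
encode-mono-≼ (inj₁ u≺v)  = encode-mono-≺ u≺v
encode-mono-≼ (inj₂ refl) = ⊑-refl _

encode-cancel-≼ : (u v : Vec ℕ n) → encode u ⊑ encode v → u ≼ v
encode-cancel-≼ []          []          _            = inj₂ refl
encode-cancel-≼ (zero ∷ u)  (zero ∷ v)  (next _ u⊑v) =
  Sum.map (next refl) (cong (0 ∷_)) (encode-cancel-≼ u v u⊑v)
encode-cancel-≼ (zero ∷ u)  (suc b ∷ v) _            = inj₁ (this z<s refl)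
encode-cancel-≼ (suc a ∷ u) (zero ∷ v)  (this ())
encode-cancel-≼ (suc a ∷ u) (suc b ∷ v) (this (s<s ()))
encode-cancel-≼ (suc a ∷ u) (suc b ∷ v) (next _ u⊑v) =
  Sum.map suc-head-≺ (λ { refl → refl }) (encode-cancel-≼ (a ∷ u) (b ∷ v) u⊑v)

encode-⊑⇔≼ : (u v : Vec ℕ n) → encode u ⊑ encode v ⇔ u ≼ v
encode-⊑⇔≼ u v = mk⇔ (encode-cancel-≼ u v) encode-mono-≼

encode-image-regular : ∀ n → Regular (Image (encode {n}))
encode-image-regular n =
  quotients⇒regular step closed Remaining nullable? quotient (∈-upTo⁺ (ℕ.n<1+n (suc n)))
  where
  Remaining : ℕ → Pred (List (Fin 2)) 0ℓ
  Remaining zero    = ∅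
  Remaining (suc m) = Image (encode {m})

  step : ℕ → Fin 2 → ℕ
  step m          0F = pred m
  step (suc zero) 1F = zero
  step m          1F = m

  step≤ : ∀ m a → step m a ≤ m
  step≤ m             0F = ℕ.pred[n]≤n
  step≤ zero          1F = z≤n
  step≤ (suc zero)    1F = z≤n
  step≤ (suc (suc m)) 1F = ℕ.≤-refl

  closed : ∀ {m} a → m ∈ upTo (suc (suc n)) → step m a ∈ upTo (suc (suc n))
  closed a m∈ = ∈-upTo⁺ (ℕ.≤-<-trans (step≤ _ a) (∈-upTo⁻ m∈))

  nullable? : ∀ m → Dec (Remaining m [])
  nullable? zero          = no λ ()
  nullable? (suc zero)    = yes ([] , refl)
  nullable? (suc (suc m)) = no λ { (zero ∷ _ , ()) ; (suc _ ∷ _ , ()) }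

  quotient : ∀ m a w → Remaining (step m a) w ⇔ Remaining m (a ∷ w)
  quotient zero          0F w = mk⇔ (λ ()) (λ ())
  quotient zero          1F w = mk⇔ (λ ()) (λ ())
  quotient (suc zero)    0F w = mk⇔ (λ ()) λ { ([] , ()) }
  quotient (suc zero)    1F w = mk⇔ (λ ()) λ { ([] , ()) }
  quotient (suc (suc m)) 0F w = mk⇔ (λ { (v , refl) → 0 ∷ v , refl })
                                    (λ { (zero ∷ v , refl) → v , refl })
  quotient (suc (suc m)) 1F w = mk⇔ (λ { (a ∷ v , refl) → suc a ∷ v , refl })
                                    (λ { (suc a ∷ v , refl) → a ∷ v , refl })

theorem1 : ExcludedMiddle (Level.suc 0ℓ) →
    (α : Ord) →
    (Σ AutomaticWFPO (λ P → AutomaticWFPO.height P ≈ₒ α)) ⇔ (α <ₒ ω^ω)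
theorem1 em α = mk⇔ bounded realised
  where
  em₀ : ExcludedMiddle 0ℓ
  em₀ {X} = map′ lower lift (em {Lift _ X})

  bounded : Σ AutomaticWFPO (λ P → AutomaticWFPO.height P ≈ₒ α) → α <ₒ ω^ω
  bounded (P , _ , α≤height) = ≤ₒ-<ₒ-trans α≤height (UpperBound.height<ω^ω em₀ P)

  realised : α <ₒ ω^ω → Σ AutomaticWFPO (λ P → AutomaticWFPO.height P ≈ₒ α)
  realised (n , α≤ω^n) with Classical.cantorNormalForm em₀ (≤ω^⇒<ω^suc n α≤ω^n)
  ... | d , α≈d = segment , ≈ₒ-trans height≈⟦d⟧ (swap α≈d)
    where open InitialSegment (encode-image-regular (suc n)) ⊑-regular₂ encode-⊑⇔≼ d
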